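{- Let $K$ be a power of two and let $\mathcal S_1,\dots,\mathcal S_K$ be sorted sequences of strings with LCP arrays $H_1,\dots,H_K$, all strings having a common prefix of length $\bar h$. The $K$-way LCP-merge described in the context outputs the sorted sequence $\mathcal S_0$ of all $n=\sum_k|\mathcal S_k|$ strings together with its LCP array $H_0$, and it performs at most $\Delta L + n\log_2 K + K$ character comparisons, where $\Delta L = L(H_0)-\sum_{k=1}^K L(H_k)$.
   Context: Strings are zero-terminated finite sequences over a totally ordered alphabet, ordered lexicographically; $\mathrm{lcp}(s,t)$ is the length of their longest common prefix. For a sorted sequence $s_1\le\dots\le s_m$ its LCP array is $H=(\bot,h_2,\dots,h_m)$ with $h_i=\mathrm{lcp}(s_{i-1},s_i)$, and $L(H)=\sum_{i\ge2} h_i$. Each input ends with a sentinel string $\infty$ larger than all strings. LCP-Compare: given $(a,s_a,h_a)$ and $(b,s_b,h_b)$ where $h_a=\mathrm{lcp}(p,s_a)$, $h_b=\mathrm{lcp}(p,s_b)$ for some string $p\le s_a,s_b$: if $h_a<h_b$ return $(b,h_b,a,h_a)$; if $h_b<h_a$ return $(a,h_a,b,h_b)$; if $h_a=h_b$, set $h':=h_a$ and compare $s_a[h'+1]$ with $s_b[h'+1]$, incrementing $h'$ while they are equal and not the terminator; then return $(a,h_a,b,h')$ if $s_a[h'+1]\le s_b[h'+1]$ and $(b,h_b,a,h')$ otherwise. Counting convention: each loop test yielding equality is one character comparison; the final failing test together with the following $\le$ test is one comparison; cases $h_a\ne h_b$ use none. $K$-way LCP-merge (LCP-aware tournament/loser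 tree): the tree is an implicit perfect binary tree with nodes $1,\dots,K$ (node $\lceil v/2\rceil$ is the parent of $v$); input $k$ corresponds to leaf position $K+k$. Node $v\ge 2$ stores a pair $(y_v,h_v)$: the index of the loser of the game at $v$ and the LCP of that loser's current string with the winner of that game; node 1 stores the overall winner $(w,h_1)$. Let $s_k$ denote the current head of input $k$. Initialization: for $k=1,\dots,K$, start with $(x,h'):=(k,\bar h)$ at $v:=K+k$ and, while $v$ is even, set $v:=v/2$ and $(x,h',y_v,h_v):=\text{LCP-Compare}((x,s_x,h'),(y_v,s_{y_v},h_v))$; then store $(y_v,h_v):=(x,h')$; finally $w:=y_1$. Main loop (repeated $n$ times): output $s_w$ with LCP entry $h_1$; advance input $w$ to its next string $s_w$ and set $(x,h'):=(w,\text{the LCP-array entry of this new string in } H_w)$, $v:=K+w$; while $v>2$ set $v:=\lceil v/2\rceil$ and $(x,h',y_v,h_v):=\text{LCP-Compare}((x,s_x,h'),(y_v,s_{y_v},h_v))$; then set $(w,h_1):=(x,h')$.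
   Formalization: The initialization as described reads unset nodes (K=2: input 1 is stored at leaf 3 and never read; input 2 meets unset y_2 and y_1); here each climb continues only while v is even and v>2, and the result is stored at the parent ⌈v/2⌉. -}

module Defs where

open import Level using (Level)
open import Data.Bool.Base using (Bool; true; false; if_then_else_; _∧_)
open import Data.Nat.Base
  using (ℕ; zero; suc; _+_; _^_; _<ᵇ_; _≡ᵇ_; ⌊_/2⌋; ⌈_/2⌉; parity)
open import Data.Nat.Properties using (<-cmp)
open import Data.Parity.Base using (0ℙ; 1ℙ)
open import Data.Fin.Base using (Fin; toℕ)
open import Data.Integer.Base as ℤ using (ℤ; +_)
open import Data.List.Base
  using (List; []; _∷_; length; sum; concat; tabulate; allFin; foldl; drop)
open import Data.List.Membership.Propositional using (_∈_)
open import Data.List.Relation.Binary.Lex.NonStrict using (Lex-≤; ≤-isDecTotalOrder)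
open import Data.List.Relation.Binary.Prefix.Heterogeneous using (Prefix)
import Data.List.Relation.Unary.Sorted.TotalOrder as SortedLists
open import Data.Product.Base using (_×_; _,_; proj₁; proj₂; ∃-syntax)
open import Data.Vec.Functional using (updateAt)
open import Relation.Binary.Bundles using (TotalOrder)
open import Relation.Binary.Core using (Rel)
open import Relation.Binary.Definitions using (tri<; tri≈; tri>)
open import Relation.Binary.PropositionalEquality.Core using (_≡_)
open import Relation.Binary.Structures using (IsDecTotalOrder)
import Relation.Binary.Construct.Add.Extrema.NonStrict as Extended
open import Relation.Nullary.Decidable.Core using (does)
open import Relation.Nullary.Construct.Add.Extrema
  using (_±) renaming (⊥± to terminator; [_] to char; ⊤± to ∞char)
open import Relation.Nullary.Construct.Add.Supremum
  using (_⁺) renaming ([_] to str; ⊤⁺ to ∞)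

PowerOfTwo : ℕ → Set
PowerOfTwo K = ∃[ p ] K ≡ 2 ^ p

-- The first argument bounds the number of iterations.  At every use below it
-- is large enough for the loop to stop because its test fails.
while : ∀ {s} {S : Set s} → ℕ → (S → Bool) → (S → S) → S → S
while zero    test body s = s
while (suc n) test body s = if test s then while n test body (body s) else s

isEven : ℕ → Bool
isEven v with parity v
... | 0ℙ = true
... | 1ℙ = false

infixl 6 _[_↦_]

_[_↦_] : ∀ {b} {B : Set b} → (ℕ → B) → ℕ → B → (ℕ → B)
(f [ v ↦ x ]) u = if u ≡ᵇ v then x else f u

module LCPMerge {a ℓ : Level} {A : Set a} {_≼_ : Rel A ℓ}
                (isOrder : IsDecTotalOrder _≡_ _≼_) where

  open IsDecTotalOrder isOrder using () renaming (_≟_ to _≟ᶜ_)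
  open IsDecTotalOrder (Extended.≤±-isDecTotalOrder-≡ _≼_ isOrder) using ()
    renaming (_≤?_ to _≤±?_)

  -- The terminating zero is implicit; it reappears in charAt below.
  Str : Set a
  Str = List A

  lexOrder : TotalOrder _ _ _
  lexOrder = record
    { isTotalOrder = IsDecTotalOrder.isTotalOrder (≤-isDecTotalOrder isOrder) }

  open SortedLists lexOrder public using (Sorted)

  lcp : Str → Str → ℕ
  lcp (x ∷ s) (y ∷ t) = if does (x ≟ᶜ y) then suc (lcp s t) else 0
  lcp _       _       = 0

  -- The LCP array (⊥ , h₂ , … , hₘ) is represented by h₂ , … , hₘ.
  lcpArray : List Str → List ℕ
  lcpArray (s ∷ t ∷ ss) = lcp s t ∷ lcpArray (t ∷ ss)
  lcpArray _            = []

  L : List ℕ → ℕ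
  L = sum

  Str∞ : Set a
  Str∞ = Str ⁺

  -- charAt s i is s[i+1].  The sentinel reads ∞char, which exceeds every
  -- character, at every position.
  charAt : Str∞ → ℕ → A ±
  charAt ∞             _       = ∞char
  charAt (str [])      _       = terminator
  charAt (str (x ∷ s)) zero    = char x
  charAt (str (x ∷ s)) (suc i) = charAt (str s) i

  -- Equal and not the terminator; ∞char terminates the sentinel.
  bothSameChar : A ± → A ± → Bool
  bothSameChar (char x) (char y) = does (x ≟ᶜ y)
  bothSameChar _        _        = false

  length∞ : Str∞ → ℕ
  length∞ ∞       = 0
  length∞ (str s) = length s

  -- (winner , its LCP) , (loser , its LCP) , number of character comparisons
  lcpCompare : ∀ {I : Set} → I × Str∞ × ℕ → I × Str∞ × ℕ →
               (I × ℕ) × (I × ℕ) × ℕ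
  lcpCompare (a , sa , ha) (b , sb , hb) with <-cmp ha hb
  ... | tri< _ _ _ = (b , hb) , (a , ha) , 0
  ... | tri> _ _ _ = (a , ha) , (b , hb) , 0
  ... | tri≈ _ _ _ =
    let (h′ , equalities) =
          while (length∞ sa)
                (λ (h , _) → bothSameChar (charAt sa h) (charAt sb h))
                (λ (h , c) → suc h , suc c)
                (ha , 0)
    in if does (charAt sa h′ ≤±? charAt sb h′)
       then (a , ha) , (b , h′) , suc equalities
       else (b , hb) , (a , h′) , suc equalities

  -- Fin index k stands for the paper's input toℕ k + 1, so its leaf position
  -- is K + suc (toℕ k).
  module Merge {K : ℕ} (S : Fin K → List Str) (H : Fin K → List ℕ) (h̄ : ℕ) where

    numStrings : ℕ
    numStrings = sum (tabulate λ k → length (S k))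

    Player : Set
    Player = Fin K × ℕ

    record State : Set a where
      constructor state
      field
        -- The unread strings, beginning with the current one, and the LCP
        -- entries of the strings following the current one.
        rest : Fin K → List Str × List ℕ
        -- node v = (y_v , h_v) for v ≥ 2 and node 1 = (w , h₁).
        node : ℕ → Player
        cost : ℕ

    open State public

    current : State → Fin K → Str∞
    current σ k with proj₁ (rest σ k)
    ... | []    = ∞
    ... | s ∷ _ = str s

    -- Falling off the end of H yields the entry of the sentinel,
    -- which has no character in common with any string.
    nextEntry : State → Fin K → ℕ
    nextEntry σ k with proj₂ (rest σ k)
    ... | []    = 0
    ... | h ∷ _ = h

    advance : Fin K → State → State
    advance k σ = record σ
      { rest = updateAt (rest σ) k λ (ss , hs) → drop 1 ss , drop 1 hs }

    Position : Set a
    Position = ℕ × Player × State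

    playAt : ℕ → Player → State → Position
    playAt v (x , h) σ =
      let (y , hy) = node σ v
          (winner , loser , c) =
            lcpCompare (x , current σ x , h) (y , current σ y , hy)
      in v , winner , record σ { node = node σ [ v ↦ loser ] ; cost = cost σ + c }

    -- The climb stops at the first odd node or at the root game, node 2, and
    -- the result is left at the parent: a later climb meets it there as its
    -- opponent, or, at node 1, it is the overall winner.
    insert : State → Fin K → State
    insert σ k =
      let (v , p , σ′) =
            while {S = Position} (K + suc (toℕ k))
                  (λ (v , _) → isEven v ∧ (2 <ᵇ v))
                  (λ (v , p , σ) → playAt ⌊ v /2⌋ p σ)
                  (K + suc (toℕ k) , (k , h̄) , σ)
      in record σ′ { node = node σ′ [ ⌈ v /2⌉ ↦ p ] }

    replay : Fin K → State → State
    replay w σ =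
      let (_ , p , σ′) =
            while {S = Position} (K + suc (toℕ w))
                  (λ (v , _) → 2 <ᵇ v)
                  (λ (v , p , σ) → playAt ⌈ v /2⌉ p σ)
                  (K + suc (toℕ w) , (w , nextEntry σ w) , advance w σ)
      in record σ′ { node = node σ′ [ 1 ↦ p ] }

    mainLoop : ℕ → State → List (Str∞ × ℕ) × State
    mainLoop zero    σ = [] , σ
    mainLoop (suc n) σ =
      let (w , h₁)   = node σ 1
          (out , σ′) = mainLoop n (replay w σ)
      in (current σ w , h₁) ∷ out , σ′

    -- memory is the arbitrary content of the tree before initialization.
    initialize : (memory : ℕ → Player) → State
    initialize memory = foldl insert (state (λ k → S k , H k) memory 0) (allFin K)

    run : (memory : ℕ → Player) → List (Str∞ × ℕ) × State
    run memory = mainLoop numStrings (initialize memory)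

    output : (memory : ℕ → Player) → List (Str∞ × ℕ)
    output memory = proj₁ (run memory)

    comparisons : (memory : ℕ → Player) → ℕ
    comparisons memory = cost (proj₂ (run memory))

  allStrings : ∀ {K} → (Fin K → List Str) → List Str
  allStrings S = concat (tabulate S)

  HaveCommonPrefix : ℕ → List Str → Set a
  HaveCommonPrefix h̄ ss =
    ∃[ c ] length c ≡ h̄ × (∀ {s} → s ∈ ss → Prefix _≡_ c s)

  ΔL : ∀ {K} → List ℕ → (Fin K → List ℕ) → ℤ
  ΔL H₀ H = + L H₀ ℤ.- + sum (tabulate λ k → L (H k))

{-# OPTIONS --safe #-}

-- The string last written is a lower bound q of all current strings, and on the
-- path of the next replay every stored entry is the LCP of a loser with q.  So
-- comparing entries decides a game whenever they differ (the larger entry is the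
-- smaller string), and otherwise the scan starts at a common prefix of both.
-- Apart from its last test, a game spends one comparison for each unit by which
-- it raises the loser's entry.  The entries in the tree are therefore a potential:
-- those of the input arrays flow in, those of H₀ flow out, and the raises are
-- paid for by the difference ΔL.  The last tests number K − 1 during
-- initialization and log₂ K for each string written.
module Submission where

open import Defs
import Algebra.Properties.CommutativeSemigroup
open import Data.Bool.Base using (Bool; true; false; not; if_then_else_; _∧_; T)
open import Data.Bool.Properties using (not-involutive)
open import Data.Empty using (⊥-elim)
open import Data.Fin.Base using (Fin; toℕ; _↑ˡ_; _↑ʳ_) renaming (zero to fzero; suc to fsuc)
open import Data.Fin.Properties using (toℕ-injective; toℕ-↑ˡ; toℕ-↑ʳ)
  renaming (suc-injective to fsuc-injective; _≟_ to _≟ᶠ_)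
import Data.Integer.Properties as ℤₚ
import Data.Integer.Tactic.RingSolver as ℤSolver
open import Data.List.Base
  using (List; []; _∷_; map; drop; length; foldl; _++_; concat; tabulate; allFin)
open import Data.List.Membership.Propositional.Properties
  using (∈-allFin; ∈-tabulate⁺; ∈-concat⁺′)
open import Data.List.Properties using (foldl-++; ++-identityʳ; tabulate-cong)
open import Data.List.Relation.Binary.Lex using (base; halt; this; next)
open import Data.List.Relation.Binary.Permutation.Propositional
  using (_↭_; prep; ↭-reflexive; ↭-trans; ↭-sym)
open import Data.List.Relation.Binary.Permutation.Propositional.Properties using (++⁺ˡ; shift)
open import Data.List.Relation.Binary.Prefix.Heterogeneous as Prefix using (Prefix)
open import Data.List.Relation.Unary.All as All using (All)
open import Data.List.Relation.Unary.All.Properties using (++⁺)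
open import Data.List.Relation.Unary.Linked as Linked using ()
open import Data.Nat.Base
open import Data.Nat.ListAction using (sum)
open import Data.Nat.Logarithm using (⌊log₂_⌋; ⌊log₂[2^n]⌋≡n)
open import Data.Nat.Properties
open import Data.Nat.Tactic.RingSolver using (solve-∀; solve)
open import Data.Product.Base using (_×_; _,_; ∃-syntax; proj₁; proj₂)
open import Data.Sum.Base using (_⊎_; inj₁; inj₂)
open import Data.Unit.Base using (tt)
open import Data.Vec.Functional using (updateAt)
open import Data.Vec.Functional.Properties using (updateAt-updates; updateAt-minimal)
open import Function.Base using (_∘_)
open import Level using ()
open import Relation.Binary.Bundles using (TotalOrder)
import Relation.Binary.Construct.Add.Extrema.NonStrict as Extended
import Relation.Binary.Construct.Add.Infimum.NonStrict as Inf
import Relation.Binary.Construct.Add.Supremum.NonStrict as Sup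
open import Relation.Binary.Core using (Rel)
open import Relation.Binary.Definitions using (tri<; tri≈; tri>)
open import Relation.Binary.PropositionalEquality
open import Relation.Binary.Structures using (IsDecTotalOrder)
open import Relation.Nullary.Construct.Add.Extrema
  using (_±) renaming (⊥± to terminator; [_] to char; ⊤± to ∞char)
open import Relation.Nullary.Construct.Add.Supremum
  using () renaming ([_] to str; ⊤⁺ to ∞)
open import Relation.Nullary.Decidable.Core using (does; yes; no)
open import Relation.Nullary.Negation.Core using (¬_; contradiction)

open Algebra.Properties.CommutativeSemigroup +-commutativeSemigroup using (x∙yz≈y∙xz)

-- Unfolding bounded loops

while-stop : ∀ {s} {S : Set s} n {test : S → Bool} {body : S → S} {s : S} →
             test s ≡ false → while n test body s ≡ s
while-stop zero    _ = refl
while-stop (suc n) stop rewrite stop = refl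

while-step : ∀ {s} {S : Set s} n {test : S → Bool} {body : S → S} {s : S} →
             test s ≡ true → while (suc n) test body s ≡ while n test body (body s)
while-step n go rewrite go = refl

-- Addresses and subtrees of the tournament tree

-- Node v is addressed as suc m, so that its children, nodes 2v − 1 and 2v, are
-- those addressed by m + m and suc (m + m), and Fin index k has the address K + toℕ k.
child : Bool → ℕ → ℕ
child false m = m + m
child true  m = suc (m + m)

infix 4 _⊑_

-- Halving leads from `u` to `m`, that is, `u` lies in the subtree of `m`. Address 0 (node 1) is its
-- own left child, so the strict facts below ask for `1 ≤ m`.
data _⊑_ : ℕ → ℕ → Set where
  here  : ∀ {m} → m ⊑ m
  above : ∀ {u m} → ⌊ u /2⌋ ⊑ m → u ⊑ m

⊑⇒≥ : ∀ {u m} → u ⊑ m → m ≤ u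
⊑⇒≥ here        = ≤-refl
⊑⇒≥ (above u⊑m) = ≤-trans (⊑⇒≥ u⊑m) (⌊n/2⌋≤n _)

⊑-cases : ∀ {u m} → u ⊑ m → u ≡ m ⊎ ⌊ u /2⌋ ⊑ m
⊑-cases here        = inj₁ refl
⊑-cases (above u⊑m) = inj₂ u⊑m

parent-child : ∀ b m → ⌊ child b m /2⌋ ≡ m
parent-child false m = sym (n≡⌊n+n/2⌋ m)
parent-child true  m = sym (n≡⌈n+n/2⌉ m)

child-⊑ : ∀ b {u m} → u ⊑ child b m → u ⊑ m
child-⊑ b {m = m} here        = above (subst (_⊑ m) (sym (parent-child b m)) here)
child-⊑ b         (above u⊑c) = above (child-⊑ b u⊑c)

m<child : ∀ b {m} → 1 ≤ m → m < child b m
m<child false {m} 1≤m = m<m+n m 1≤m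
m<child true  {m} 1≤m = m<n⇒m<1+n (m<m+n m 1≤m)

m⋢child : ∀ b {m} → 1 ≤ m → ¬ (m ⊑ child b m)
m⋢child b 1≤m m⊑c = <-irrefl refl (<-≤-trans (m<child b 1≤m) (⊑⇒≥ m⊑c))

child⋢sibling : ∀ b {m} → 1 ≤ m → ¬ (child b m ⊑ child (not b) m)
child⋢sibling false {m} 1≤m c⊑c′ = <-irrefl refl (⊑⇒≥ c⊑c′)
child⋢sibling true  {m} 1≤m c⊑c′ with ⊑-cases c⊑c′
... | inj₁ c≡c′ = 1+n≢n c≡c′
... | inj₂ p⊑c′ = m⋢child false 1≤m (subst (_⊑ child false m) (parent-child true m) p⊑c′)

-- Halving gives a single path from `u`. Whichever child it meets first would then lie below its own
-- sibling.
children-disjoint : ∀ b {u m} → 1 ≤ m → u ⊑ child b m → ¬ (u ⊑ child (not b) m)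
children-disjoint b     1≤m here      q = child⋢sibling b 1≤m q
children-disjoint b     1≤m (above p) q with ⊑-cases q
children-disjoint false 1≤m (above p) q | inj₁ refl = child⋢sibling true 1≤m (above p)
children-disjoint true  1≤m (above p) q | inj₁ refl = child⋢sibling false 1≤m (above p)
children-disjoint b     1≤m (above p) q | inj₂ q′   = children-disjoint b 1≤m p q′

1≤child : ∀ b {m} → 1 ≤ m → 1 ≤ child b m
1≤child b 1≤m = ≤-trans 1≤m (<⇒≤ (m<child b 1≤m))

2<1+child : ∀ b {m} → 1 ≤ m → (2 <ᵇ suc (child b m)) ≡ true
2<1+child b {m} 1≤m with child b m | ≤-trans (s≤s 1≤m) (m<child b 1≤m)
... | suc zero    | s≤s ()
... | suc (suc _) | _ = refl

isEven-double : ∀ m → isEven (m + m) ≡ true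
isEven-double zero    = refl
isEven-double (suc m) rewrite +-suc m m = isEven-double m

isEven-1+double : ∀ m → isEven (suc (m + m)) ≡ false
isEven-1+double zero    = refl
isEven-1+double (suc m) rewrite +-suc m m = isEven-1+double m

-- Ensures that the fuel of a replay, which is at least `K`, covers the `p` levels of the tree.
n≤2^n : ∀ n → n ≤ 2 ^ n
n≤2^n zero    = z≤n
n≤2^n (suc n) = +-mono-≤ (m^n>0 2 n) (≤-trans (n≤2^n n) (m≤m+n _ 0))

-- Updates, and sums and concatenations over all inputs

updated-same : ∀ {b} {B : Set b} (f : ℕ → B) v x → (f [ v ↦ x ]) v ≡ x
updated-same f v x with v ≡ᵇ v in eq
... | true  = refl
... | false = ⊥-elim (subst T eq (≡⇒≡ᵇ v v refl))

updated-other : ∀ {b} {B : Set b} (f : ℕ → B) v x {u} → u ≢ v → (f [ v ↦ x ]) u ≡ f u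
updated-other f v x {u} u≢v with u ≡ᵇ v in eq
... | true  = contradiction (≡ᵇ⇒≡ u v (subst T (sym eq) tt)) u≢v
... | false = refl

tabulate-+ : ∀ {b} {B : Set b} m {n} (f : Fin (m + n) → B) →
             tabulate f ≡ tabulate (λ i → f (i ↑ˡ n)) ++ tabulate (λ j → f (m ↑ʳ j))
tabulate-+ zero    f = refl
tabulate-+ (suc m) f = cong (f fzero ∷_) (tabulate-+ m (f ∘ fsuc))

-- For the totals that drop when input `w` alone advances: the number of unread strings and the sum
-- of unread LCP entries.
sum-tabulate-change : ∀ {n} (f g : Fin n → ℕ) w {c} → f w ≡ c + g w →
                      (∀ k → k ≢ w → f k ≡ g k) → sum (tabulate f) ≡ c + sum (tabulate g)
sum-tabulate-change f g fzero {c} at-w others = trans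
  (cong₂ _+_ at-w (cong sum (tabulate-cong λ k → others (fsuc k) λ ())))
  (+-assoc c _ _)
sum-tabulate-change f g (fsuc w) {c} at-w others = trans
  (cong₂ _+_ (others fzero λ ())
    (sum-tabulate-change (f ∘ fsuc) (g ∘ fsuc) w at-w
      λ k k≢w → others (fsuc k) (k≢w ∘ fsuc-injective)))
  (x∙yz≈y∙xz (g fzero) c _)

sum-tabulate-0 : ∀ {n} (f : Fin n → ℕ) → (∀ k → f k ≡ 0) → sum (tabulate f) ≡ 0
sum-tabulate-0 {zero}  f f≡0 = refl
sum-tabulate-0 {suc n} f f≡0 = cong₂ _+_ (f≡0 fzero) (sum-tabulate-0 (f ∘ fsuc) (f≡0 ∘ fsuc))

sum-tabulate≡0 : ∀ {n} (f : Fin n → ℕ) → sum (tabulate f) ≡ 0 → ∀ k → f k ≡ 0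
sum-tabulate≡0 f sum≡0 fzero    = m+n≡0⇒m≡0 (f fzero) sum≡0
sum-tabulate≡0 f sum≡0 (fsuc k) = sum-tabulate≡0 (f ∘ fsuc) (m+n≡0⇒n≡0 (f fzero) sum≡0) k

concat-tabulate-[] : ∀ {b} {B : Set b} {n} (f : Fin n → List B) → (∀ k → f k ≡ []) →
                     concat (tabulate f) ≡ []
concat-tabulate-[] {n = zero}  f f≡[] = refl
concat-tabulate-[] {n = suc n} f f≡[] =
  cong₂ _++_ (f≡[] fzero) (concat-tabulate-[] (f ∘ fsuc) (f≡[] ∘ fsuc))

-- The removed element has to pass the inputs before `w`, hence a permutation instead of an
-- equality.
concat-tabulate-uncons : ∀ {b} {B : Set b} {n} (f g : Fin n → List B) w {x} →
                         f w ≡ x ∷ g w → (∀ k → k ≢ w → f k ≡ g k) →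
                         concat (tabulate f) ↭ x ∷ concat (tabulate g)
concat-tabulate-uncons f g fzero at-w others = ↭-reflexive
  (cong₂ _++_ at-w (cong concat (tabulate-cong λ k → others (fsuc k) λ ())))
concat-tabulate-uncons f g (fsuc w) at-w others
  rewrite others fzero (λ ()) = ↭-trans
  (++⁺ˡ (g fzero) (concat-tabulate-uncons (f ∘ fsuc) (g ∘ fsuc) w at-w
    λ k k≢w → others (fsuc k) (k≢w ∘ fsuc-injective)))
  (shift _ (g fzero) _)

module _ {a ℓ} {A : Set a} {_≼_ : Rel A ℓ} (isOrder : IsDecTotalOrder _≡_ _≼_) where

  open LCPMerge isOrder
  open IsDecTotalOrder isOrder using () renaming (_≟_ to _≟ᶜ_)
  open IsDecTotalOrder (Extended.≤±-isDecTotalOrder-≡ _≼_ isOrder) using ()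
    renaming (_≤?_ to _≤±?_; total to ≤±-total)
  open TotalOrder lexOrder using () renaming (_≤_ to _≤ₗ_; refl to ≤ₗ-refl)

  private
    infix 4 _≤±_
    _≤±_ : Rel (A ±) _
    _≤±_ = Extended._≤±_ _≼_

  -- Longest common prefixes and lexicographic order

  lcp-sym : ∀ s t → lcp s t ≡ lcp t s
  lcp-sym []      []      = refl
  lcp-sym []      (_ ∷ _) = refl
  lcp-sym (_ ∷ _) []      = refl
  lcp-sym (x ∷ s) (y ∷ t) with x ≟ᶜ y | y ≟ᶜ x
  ... | yes _    | yes _    = cong suc (lcp-sym s t)
  ... | no  _    | no  _    = refl
  ... | yes refl | no  x≢x  = contradiction refl x≢x
  ... | no  x≢x  | yes refl = contradiction refl x≢x

  -- Agreement in the first `h` characters passes through `q`. Hence the scan between two players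
  -- with equal entries may start at that entry.
  lcp-ultrametric : ∀ h q s t → h ≤ lcp q s → h ≤ lcp q t → h ≤ lcp s t
  lcp-ultrametric zero    _       _       _       _  _  = z≤n
  lcp-ultrametric (suc h) (x ∷ q) (y ∷ s) (z ∷ t) hs ht
    with x ≟ᶜ y | x ≟ᶜ z | y ≟ᶜ z
  ... | yes refl | yes refl | yes _   = s≤s (lcp-ultrametric h q s t (≤-pred hs) (≤-pred ht))
  ... | yes refl | yes refl | no  x≢x = contradiction refl x≢x

  -- At position `lcp q s` the string `t` still agrees with `q`, while `s` already exceeds it; so
  -- `s` exceeds `t` at the same place. This decides games without reading a character.
  larger-lcp⇒≤ : ∀ q s t → q ≤ₗ s → lcp q s < lcp q t → t ≤ₗ s × lcp t s ≡ lcp q s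
  larger-lcp⇒≤ (x ∷ q) (z ∷ s) (y ∷ t) q≤s lt with x ≟ᶜ z | x ≟ᶜ y
  larger-lcp⇒≤ (x ∷ q) (z ∷ s) (y ∷ t) (this (_ , x≢x)) lt | yes refl | _ = contradiction refl x≢x
  larger-lcp⇒≤ (x ∷ q) (x ∷ s) (x ∷ t) (next _ q≤s) lt | yes refl | yes refl
    with x ≟ᶜ x | larger-lcp⇒≤ q s t q≤s (≤-pred lt)
  ... | yes _  | t≤s , eq = next refl t≤s , cong suc eq
  ... | no x≢x | _        = contradiction refl x≢x
  larger-lcp⇒≤ (x ∷ q) (z ∷ s) (y ∷ t) (next x≡z _) lt | no x≢z | _ = contradiction x≡z x≢z
  larger-lcp⇒≤ (x ∷ q) (z ∷ s) (x ∷ t) (this x<z)   lt | no x≢z | yes refl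
    with x ≟ᶜ z
  ... | yes x≡z = contradiction x≡z x≢z
  ... | no  _   = this x<z , refl

  sameChar-below-lcp : ∀ s t h → h < lcp s t →
                       bothSameChar (charAt (str s) h) (charAt (str t) h) ≡ true
  sameChar-below-lcp (x ∷ s) (y ∷ t) h h<lcp with x ≟ᶜ y in x≟y
  sameChar-below-lcp (x ∷ s) (y ∷ t) zero    _     | yes _ = cong does x≟y
  sameChar-below-lcp (x ∷ s) (y ∷ t) (suc h) h<lcp | yes _ =
    sameChar-below-lcp s t h (≤-pred h<lcp)

  -- When both strings end at this position the test fails too, since `bothSameChar` rejects
  -- terminators.
  mismatch-at-lcp : ∀ s t →
    bothSameChar (charAt (str s) (lcp s t)) (charAt (str t) (lcp s t)) ≡ false
  mismatch-at-lcp []      _       = refl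
  mismatch-at-lcp (x ∷ s) []      = refl
  mismatch-at-lcp (x ∷ s) (y ∷ t) with x ≟ᶜ y in x≟y
  ... | yes _ = mismatch-at-lcp s t
  ... | no  _ = cong does x≟y

  lcp≤length : ∀ s t → lcp s t ≤ length s
  lcp≤length []      _       = z≤n
  lcp≤length (x ∷ s) []      = z≤n
  lcp≤length (x ∷ s) (y ∷ t) with x ≟ᶜ y
  ... | yes _ = s≤s (lcp≤length s t)
  ... | no  _ = z≤n

  -- The first mismatch decides the order; a string that ends there reads the terminator, the least
  -- symbol.
  charAt-lcp-≤⇒≤ : ∀ s t → charAt (str s) (lcp s t) ≤± charAt (str t) (lcp s t) → s ≤ₗ t
  charAt-lcp-≤⇒≤ []      []      _ = base _
  charAt-lcp-≤⇒≤ []      (_ ∷ _) _ = halt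
  charAt-lcp-≤⇒≤ (x ∷ s) []      Sup.[ () ]
  charAt-lcp-≤⇒≤ (x ∷ s) (y ∷ t) c≤c′ with x ≟ᶜ y
  ... | yes x≡y = next x≡y (charAt-lcp-≤⇒≤ s t c≤c′)
  charAt-lcp-≤⇒≤ (x ∷ s) (y ∷ t) Sup.[ Inf.[ x≼y ] ] | no x≢y = this (x≼y , x≢y)

  charAt-lcp-≰⇒≥ : ∀ s t → ¬ (charAt (str s) (lcp s t) ≤± charAt (str t) (lcp s t)) → t ≤ₗ s
  charAt-lcp-≰⇒≥ s t c≰c′ with ≤±-total (charAt (str s) (lcp s t)) (charAt (str t) (lcp s t))
  ... | inj₁ c≤c′ = contradiction c≤c′ c≰c′
  ... | inj₂ c′≤c rewrite lcp-sym s t = charAt-lcp-≤⇒≤ t s c′≤c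

  -- The scan for the first mismatch

  scan : ℕ → Str∞ → Str∞ → ℕ × ℕ → ℕ × ℕ
  scan n sa sb =
    while n (λ (h , _) → bothSameChar (charAt sa h) (charAt sb h))
            (λ (h , c) → suc h , suc c)

  -- Each iteration trades one unit of fuel for one increment of `h`, and the mismatch lies no
  -- further than `length s`, so the fuel lasts. The counter starts at an arbitrary `c` for the sake
  -- of the induction.
  scan-lcp : ∀ n s t h c → h ≤ lcp s t → length s ≤ n + h →
             ∃[ e ] scan n (str s) (str t) (h , c) ≡ (lcp s t , e) × e + h ≡ c + lcp s t
  scan-lcp n s t h c h≤lcp enough with m≤n⇒m<n∨m≡n h≤lcp
  ... | inj₂ refl = c , while-stop n (mismatch-at-lcp s t) , refl
  scan-lcp zero s t h c h≤lcp enough | inj₁ h<lcp =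
    contradiction (<-≤-trans h<lcp (≤-trans (lcp≤length s t) enough)) (<-irrefl refl)
  scan-lcp (suc n) s t h c h≤lcp enough | inj₁ h<lcp
    with e , eq , count ← scan-lcp n s t (suc h) (suc c) h<lcp
                            (≤-trans enough (≤-reflexive (sym (+-suc n h)))) =
    e , trans (while-step n (sameChar-below-lcp s t h h<lcp)) eq ,
    suc-injective (trans (sym (+-suc e h)) count)

  sentinel-mismatch : ∀ c → bothSameChar c ∞char ≡ false
  sentinel-mismatch terminator = refl
  sentinel-mismatch (char _)   = refl
  sentinel-mismatch ∞char      = refl

  -- Lets the common prefix act as the string written before the first one.
  prefix-below : ∀ {c s} → Prefix _≡_ c s → c ≤ₗ s × lcp c s ≡ length c
  prefix-below {s = []}    Prefix.[] = base _ , refl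
  prefix-below {s = _ ∷ _} Prefix.[] = halt , refl
  prefix-below {c = x ∷ _} (refl Prefix.∷ c⊑s) with prefix-below c⊑s | x ≟ᶜ x
  ... | c≤s , eq | yes _   = next refl c≤s , cong suc eq
  ... | _        | no  x≢x = contradiction refl x≢x

  prefix-lcp : ∀ {c s t} → Prefix _≡_ c s → Prefix _≡_ c t → length c ≤ lcp s t
  prefix-lcp {c} {s} {t} c⊑s c⊑t = lcp-ultrametric (length c) c s t
    (≤-reflexive (sym (proj₂ (prefix-below c⊑s)))) (≤-reflexive (sym (proj₂ (prefix-below c⊑t))))

  -- One comparison and its amortised cost

  -- Sentinels weigh nothing, since those of empty inputs keep the entry h̄ to the end.
  weight : Str∞ → ℕ → ℕ
  weight ∞       _ = 0
  weight (str _) h = h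

  module _ (h̄ : ℕ) where

    -- Follows sa h sb: the LCP entry h is valid for sb relative to sa ≤ sb.  For
    -- the sentinel any entry up to h̄ will do: an empty input starts with h̄.
    data Follows : Str∞ → ℕ → Str∞ → Set (a Level.⊔ ℓ) where
      string   : ∀ {s h t} → s ≤ₗ t → lcp s t ≡ h → h̄ ≤ h → Follows (str s) h (str t)
      sentinel : ∀ {sa h} → h ≤ h̄ → Follows sa h ∞

    -- The winner keeps its entry, and the loser's becomes relative to the winner. The inequality is
    -- the amortised cost: all comparisons but one are paid for by the rise of the loser's weight.
    data Outcome {I : Set} (x : I) (sx : Str∞) (hx : ℕ) (y : I) (sy : Str∞) (hy : ℕ) :
                 (I × ℕ) × (I × ℕ) × ℕ → Set (a Level.⊔ ℓ) where
      first  : ∀ {h c} → Follows sx h sy → c + weight sy hy ≤ suc (weight sy h) →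
               Outcome x sx hx y sy hy ((x , hx) , (y , h) , c)
      second : ∀ {h c} → Follows sy h sx → c + weight sx hx ≤ suc (weight sx h) →
               Outcome x sx hx y sy hy ((y , hy) , (x , h) , c)

    module _ {I : Set} (x : I) (hx : ℕ) (y : I) (hy : ℕ) where

      -- The end of the equal-entries branch of `lcpCompare` with the result of the scan as an
      -- argument, so that a known result can be substituted for the loop.
      settle : Str∞ → Str∞ → ℕ × ℕ → (I × ℕ) × (I × ℕ) × ℕ
      settle sx sy (h , equalities) =
        if does (charAt sx h ≤±? charAt sy h)
        then (x , hx) , (y , h) , suc equalities
        else (y , hy) , (x , h) , suc equalities

      settle-strings : ∀ s t e → e + hx ≡ lcp s t → hx ≡ hy → h̄ ≤ hx →
        Outcome x (str s) hx y (str t) hy (settle (str s) (str t) (lcp s t , e))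
      settle-strings s t e count refl h̄≤h
        with h̄≤lcp ← ≤-trans h̄≤h (≤-trans (m≤n+m hx e) (≤-reflexive count))
        with charAt (str s) (lcp s t) ≤±? charAt (str t) (lcp s t)
      ... | yes c≤c′ = first (string (charAt-lcp-≤⇒≤ s t c≤c′) refl h̄≤lcp)
                             (≤-reflexive (cong suc count))
      ... | no  c≰c′ = second (string (charAt-lcp-≰⇒≥ s t c≰c′) (lcp-sym t s) h̄≤lcp)
                              (≤-reflexive (cong suc count))

      -- Unequal entries are settled between strings by `larger-lcp⇒≤`. Against a string, a sentinel
      -- never has the larger entry, as `h̄` separates the two; if the entries tie, `∞char` makes it
      -- lose.
      lcpCompare-outcome : ∀ {q sx sy} → Follows (str q) hx sx → Follows (str q) hy sy →
        Outcome x sx hx y sy hy (lcpCompare (x , sx , hx) (y , sy , hy))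
      lcpCompare-outcome fx fy with <-cmp hx hy
      lcpCompare-outcome (sentinel hx≤h̄) fy | tri< _ _ _ = second (sentinel hx≤h̄) z≤n
      lcpCompare-outcome (string _ _ h̄≤hx) (sentinel hy≤h̄) | tri< hx<hy _ _ =
        contradiction (<-≤-trans hx<hy (≤-trans hy≤h̄ h̄≤hx)) (<-irrefl refl)
      lcpCompare-outcome {q} {str s} {str t} (string q≤s refl h̄≤hx) (string q≤t refl _) | tri< hx<hy _ _
        with t≤s , eq ← larger-lcp⇒≤ q s t q≤s hx<hy = second (string t≤s eq h̄≤hx) (n≤1+n _)
      lcpCompare-outcome fx (sentinel hy≤h̄) | tri> _ _ _ = first (sentinel hy≤h̄) z≤n
      lcpCompare-outcome (sentinel hx≤h̄) (string _ _ h̄≤hy) | tri> _ _ hy<hx =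
        contradiction (<-≤-trans hy<hx (≤-trans hx≤h̄ h̄≤hy)) (<-irrefl refl)
      lcpCompare-outcome {q} {str s} {str t} (string q≤s refl _) (string q≤t refl h̄≤hy) | tri> _ _ hy<hx
        with s≤t , eq ← larger-lcp⇒≤ q t s q≤t hy<hx = first (string s≤t eq h̄≤hy) (n≤1+n _)
      -- For `sx = ∞` the loop has fuel `length∞ ∞`, which is 0, so the verdict falls at position
      -- `hx` at once.
      lcpCompare-outcome {sy = sy} (sentinel hx≤h̄) fy | tri≈ _ _ _ with ∞char ≤±? charAt sy hx
      ... | no  _ = second (sentinel hx≤h̄) ≤-refl
      lcpCompare-outcome {sy = ∞} (sentinel hx≤h̄) fy | tri≈ _ _ _ | yes _ =
        first (sentinel hx≤h̄) ≤-refl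
      lcpCompare-outcome {sy = str t} (sentinel hx≤h̄) fy | tri≈ _ _ _ | yes c≤c′ =
        contradiction c≤c′ (∞char≰charAt t hx)
        where
        ∞char≰charAt : ∀ t h → ¬ (∞char ≤± charAt (str t) h)
        ∞char≰charAt []      h       ()
        ∞char≰charAt (c ∷ t) zero    ()
        ∞char≰charAt (c ∷ t) (suc h) = ∞char≰charAt t h
      lcpCompare-outcome {sx = str s} (string _ _ _) (sentinel hy≤h̄) | tri≈ _ refl _ =
        subst (λ r → Outcome x (str s) hx y ∞ hy (settle (str s) ∞ r))
          (sym (while-stop (length s) (sentinel-mismatch (charAt (str s) hx))))
          settle-sentinel
        where
        settle-sentinel : Outcome x (str s) hx y ∞ hy (settle (str s) ∞ (hx , 0))
        settle-sentinel with charAt (str s) hx ≤±? ∞char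
        ... | yes _    = first (sentinel hy≤h̄) ≤-refl
        ... | no  c≰∞ = contradiction (Extended._≤⊤± _≼_ (charAt (str s) hx)) c≰∞
      lcpCompare-outcome {q} {str s} {str t} (string _ q-s h̄≤hx) (string _ q-t _) | tri≈ _ hx≡hy _
        with e , eq , count ← scan-lcp (length s) s t hx 0
               (lcp-ultrametric hx q s t (≤-reflexive (sym q-s))
                                         (≤-reflexive (trans hx≡hy (sym q-t))))
               (m≤m+n (length s) hx) =
        subst (λ r → Outcome x (str s) hx y (str t) hy (settle (str s) (str t) r))
          (sym eq) (settle-strings s t e count hx≡hy h̄≤hx)

  module _ {K : ℕ} (S : Fin K → List Str) (H : Fin K → List ℕ) (h̄ : ℕ) where

    open Merge S H h̄

    -- The tree invariant

    Unread : Set a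
    Unread = Fin K → List Str × List ℕ

    head∞ : List Str → Str∞
    head∞ []      = ∞
    head∞ (s ∷ _) = str s

    -- Unlike `current`, this depends on the unread input alone, so invariants stated with it
    -- survive changes of nodes and cost.
    heads : Unread → Fin K → Str∞
    heads r k = head∞ (proj₁ (r k))

    current≡heads : ∀ r nd c k → current (state r nd c) k ≡ heads r k
    current≡heads r nd c k with proj₁ (r k)
    ... | []    = refl
    ... | _ ∷ _ = refl

    -- Won cur nd d m x φ: the games of the subtree of height d below address m are
    -- settled with winner x, and the losers' entries in it have total weight φ.
    data Won (cur : Fin K → Str∞) (nd : ℕ → Player) :
             ℕ → ℕ → Fin K → ℕ → Set (a Level.⊔ ℓ) where
      leaf : ∀ {m x} → K + toℕ x ≡ m → Won cur nd 0 m x 0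
      game : ∀ b {d m x y h φ ψ χ} →
             Won cur nd d (child b m) x φ → Won cur nd d (child (not b) m) y ψ →
             nd (suc m) ≡ (y , h) → Follows h̄ (cur x) h (cur y) →
             χ ≡ weight (cur y) h + (φ + ψ) → Won cur nd (suc d) m x χ

    winner-⊑ : ∀ {cur nd d m x φ} → Won cur nd d m x φ → K + toℕ x ⊑ m
    winner-⊑ (leaf refl)        = here
    winner-⊑ (game b l _ _ _ _) = child-⊑ b (winner-⊑ l)

    -- Frame property: a settled subtree depends only on its own nodes and players, so games
    -- elsewhere leave it settled.
    Won-cong : ∀ {cur nd cur′ nd′ d m x φ} →
               (∀ u → u ⊑ m → nd′ (suc u) ≡ nd (suc u)) →
               (∀ k → K + toℕ k ⊑ m → cur′ k ≡ cur k) →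
               Won cur nd d m x φ → Won cur′ nd′ d m x φ
    Won-cong nd≡ cur≡ (leaf eq) = leaf eq
    Won-cong {cur′ = cur′} nd≡ cur≡ (game b {x = x} {y} {h} wx wy at-m follows χ≡) =
      game b
        (Won-cong (λ u u⊑ → nd≡ u (child-⊑ b u⊑)) (λ k k⊑ → cur≡ k (child-⊑ b k⊑)) wx)
        (Won-cong (λ u u⊑ → nd≡ u (child-⊑ (not b) u⊑)) (λ k k⊑ → cur≡ k (child-⊑ (not b) k⊑)) wy)
        (trans (nd≡ _ here) at-m)
        (subst₂ (λ sx sy → Follows h̄ sx h sy) (sym cur≡x) (sym cur≡y) follows)
        (trans χ≡ (cong (λ sy → weight sy h + _) (sym cur≡y)))
      where
      cur≡x = cur≡ x (child-⊑ b (winner-⊑ wx))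
      cur≡y = cur≡ y (child-⊑ (not b) (winner-⊑ wy))

    Won-store : ∀ {cur nd d m x φ p} → 1 ≤ m → ∀ b → Won cur nd d (child b m) x φ →
                Won cur (nd [ suc m ↦ p ]) d (child b m) x φ
    Won-store {nd = nd} {m = m} {p = p} 1≤m b = Won-cong
      (λ u u⊑ → updated-other nd (suc m) p λ eq →
        m⋢child b 1≤m (subst (_⊑ child b m) (suc-injective eq) u⊑))
      (λ _ _ → refl)

    -- Playing one game of the tree

    playAt≡ : ∀ r nd c v x h {y hy} → nd v ≡ (y , hy) →
      let (w , l , e) = lcpCompare (x , heads r x , h) (y , heads r y , hy)
      in playAt v (x , h) (state r nd c) ≡ (v , w , state r (nd [ v ↦ l ]) (c + e))
    playAt≡ r nd c v x h {y} {hy} at-v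
      rewrite at-v | current≡heads r nd c x | current≡heads r nd c y = refl

    -- `settled` is the weight stored in the two subtrees and `competing` that of the two entrants.
    -- By `cost≤`, cost minus potential rises by at most one; `winner≤` is what initialization needs
    -- to drop the entrants' weights.
    record Played (q : Str) (r : Unread) (nd : ℕ → Player) (c d m : ℕ)
                  (settled competing : ℕ) (pos : Position) : Set (a Level.⊔ ℓ) where
      field
        {w}    : Fin K
        {hw}   : ℕ
        {nd′}  : ℕ → Player
        {c′}   : ℕ
        {χ}    : ℕ
        pos≡   : pos ≡ (suc m , (w , hw) , state r nd′ c′)
        won    : Won (heads r) nd′ (suc d) m w χ
        follows : Follows h̄ (str q) hw (heads r w)
        frame  : ∀ u → u ≢ m → nd′ (suc u) ≡ nd (suc u)
        cost≤  : c′ + (settled + competing) ≤ suc c + (χ + weight (heads r w) hw)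
        winner≤ : weight (heads r w) hw ≤ competing

    play-cost : ∀ c e φ ψ wx wy wy′ → e + wy ≤ suc wy′ →
                (c + e) + ((φ + ψ) + (wx + wy)) ≤ suc c + ((wy′ + (φ + ψ)) + wx)
    play-cost c e φ ψ wx wy wy′ e≤ = begin
      (c + e) + ((φ + ψ) + (wx + wy))    ≡⟨ rearrange c e (φ + ψ) wx wy ⟩
      (e + wy) + (c + ((φ + ψ) + wx))    ≤⟨ +-monoˡ-≤ _ e≤ ⟩
      suc wy′ + (c + ((φ + ψ) + wx))     ≡⟨ rearrange′ c wy′ (φ + ψ) wx ⟩
      suc c + ((wy′ + (φ + ψ)) + wx)     ∎
      where
      open ≤-Reasoning
      rearrange : ∀ c e f wx wy → (c + e) + (f + (wx + wy)) ≡ (e + wy) + (c + (f + wx))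
      rearrange = solve-∀
      rearrange′ : ∀ c wy f wx → suc wy + (c + (f + wx)) ≡ suc c + ((wy + f) + wx)
      rearrange′ = solve-∀

    play : ∀ {q r nd d m x h y hy φ ψ} c b → 1 ≤ m → nd (suc m) ≡ (y , hy) →
           Won (heads r) nd d (child b m) x φ → Won (heads r) nd d (child (not b) m) y ψ →
           Follows h̄ (str q) h (heads r x) → Follows h̄ (str q) hy (heads r y) →
           Played q r nd c d m (φ + ψ) (weight (heads r x) h + weight (heads r y) hy)
                  (playAt (suc m) (x , h) (state r nd c))
    play {q} {r} {nd} {d} {m} {x} {h} {y} {hy} {φ} {ψ} c b 1≤m at-m wx wy fx fy
      with lcpCompare (x , heads r x , h) (y , heads r y , hy)
         | lcpCompare-outcome h̄ x h y hy fx fy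
         | playAt≡ r nd c (suc m) x h at-m
    ... | _ , l , e | first x≤y e≤ | pos≡ = record
      { pos≡    = pos≡
      ; won     = game b (Won-store 1≤m b wx) (Won-store 1≤m (not b) wy) (updated-same nd (suc m) l) x≤y refl
      ; follows = fx
      ; frame   = λ u u≢m → updated-other nd (suc m) l (λ eq → u≢m (suc-injective eq))
      ; cost≤   = play-cost c e φ ψ (weight (heads r x) h) (weight (heads r y) hy) _ e≤
      ; winner≤ = m≤m+n _ _
      }
    ... | _ , l , e | second {h = h′} y≤x e≤ | pos≡ = record
      { pos≡    = pos≡
      -- `game` lists the winner's side first, so the children exchange roles and `not (not b)` is
      -- brought back to `b`.
      ; won     = game (not b) (Won-store 1≤m (not b) wy)
                    (subst (λ b → Won _ _ d (child b m) x φ) (sym (not-involutive b)) (Won-store 1≤m b wx))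
                    (updated-same nd (suc m) l) y≤x
                    (cong (weight (heads r x) h′ +_) (+-comm φ ψ))
      ; follows = fy
      ; frame   = λ u u≢m → updated-other nd (suc m) l (λ eq → u≢m (suc-injective eq))
      ; cost≤   = ≤-trans
          (≤-reflexive (cong (λ z → c + e + (φ + ψ + z)) (+-comm (weight (heads r x) h) _)))
          (play-cost c e φ ψ (weight (heads r y) hy) (weight (heads r x) h) _ e≤)
      ; winner≤ = m≤n+m _ _
      }

    -- Climbing after an input has advanced

    replayLoop : ℕ → Position → Position
    replayLoop n = while n (λ (v , _) → 2 <ᵇ v) (λ (v , p , σ) → playAt ⌈ v /2⌉ p σ)

    -- `reached` leaves the remaining fuel `n` arbitrary, so that the next level can spend it. The
    -- summand `d` in `cost≤` is one last test per level.
    record Climbed (q : Str) (r : Unread) (nd : ℕ → Player) (c d m : ℕ)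
                   (weightIn : ℕ) (start : Position) : Set (a Level.⊔ ℓ) where
      field
        {w}     : Fin K
        {hw}    : ℕ
        {nd′}   : ℕ → Player
        {c′}    : ℕ
        {χ}     : ℕ
        reached : ∀ n → replayLoop (d + n) start
                      ≡ replayLoop n (suc m , (w , hw) , state r nd′ c′)
        won     : Won (heads r) nd′ d m w χ
        follows : Follows h̄ (str q) hw (heads r w)
        frame   : ∀ u → ¬ (u ⊑ m) → nd′ (suc u) ≡ nd (suc u)
        cost≤   : c′ + weightIn ≤ d + c + (χ + weight (heads r w) hw)

    -- Add both accounts and cancel the intermediate `c₁ + φ₁ + w₁`. The opponent's weight `wy`
    -- leaves the old tree to enter the game.
    climb-cost : ∀ c c₁ c₂ d φ φ₁ ψ χ w₀ w₁ w₂ wy →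
                 c₁ + (φ + w₀) ≤ d + c + (φ₁ + w₁) →
                 c₂ + ((φ₁ + ψ) + (w₁ + wy)) ≤ suc c₁ + (χ + w₂) →
                 c₂ + ((wy + (φ + ψ)) + w₀) ≤ suc d + c + (χ + w₂)
    climb-cost c c₁ c₂ d φ φ₁ ψ χ w₀ w₁ w₂ wy below root =
      +-cancelˡ-≤ (c₁ + φ₁ + w₁) _ _ (begin
        (c₁ + φ₁ + w₁) + (c₂ + ((wy + (φ + ψ)) + w₀))
          ≡⟨ solve (c₁ ∷ c₂ ∷ φ ∷ φ₁ ∷ ψ ∷ w₀ ∷ w₁ ∷ wy ∷ []) ⟩
        (c₁ + (φ + w₀)) + (c₂ + ((φ₁ + ψ) + (w₁ + wy)))
          ≤⟨ +-mono-≤ below root ⟩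
        (d + c + (φ₁ + w₁)) + (suc c₁ + (χ + w₂))
          ≡⟨ solve (c ∷ c₁ ∷ d ∷ φ₁ ∷ χ ∷ w₁ ∷ w₂ ∷ []) ⟩
        (c₁ + φ₁ + w₁) + (suc d + c + (χ + w₂)) ∎)
      where open ≤-Reasoning

    climb-step : ∀ {s r nd c d b m φ ψ w₀ y hy start} → 1 ≤ m →
      (C : Climbed s r nd c d (child b m) (φ + w₀) start) → let module C = Climbed C in
      Played s r C.nd′ C.c′ d m (C.χ + ψ) (weight (heads r C.w) C.hw + weight (heads r y) hy)
             (playAt (suc m) (C.w , C.hw) (state r C.nd′ C.c′)) →
      Climbed s r nd c (suc d) m ((weight (heads r y) hy + (φ + ψ)) + w₀) start
    climb-step {s} {r} {nd} {c} {d} {b} {m} {φ} {ψ} {start = start} 1≤m C P = record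
      { reached = reached
      ; won     = P.won
      ; follows = P.follows
      ; frame   = λ u u⋢m → trans (P.frame u λ { refl → u⋢m here })
                                  (C.frame u λ u⊑c → u⋢m (child-⊑ b u⊑c))
      ; cost≤   = climb-cost c C.c′ P.c′ d φ C.χ ψ P.χ _ _ _ _ C.cost≤ P.cost≤
      }
      where
      module C = Climbed C
      module P = Played P

      reached : ∀ n → replayLoop (suc d + n) start
                    ≡ replayLoop n (suc m , (P.w , P.hw) , state r P.nd′ P.c′)
      reached n = begin
        replayLoop (suc d + n) start
          ≡⟨ cong (λ n → replayLoop n start) (sym (+-suc d n)) ⟩
        replayLoop (d + suc n) start
          ≡⟨ C.reached (suc n) ⟩
        replayLoop (suc n) (suc (child b m) , (C.w , C.hw) , state r C.nd′ C.c′)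
          ≡⟨ while-step n (2<1+child b 1≤m) ⟩
        replayLoop n (playAt (suc ⌊ child b m /2⌋) (C.w , C.hw) (state r C.nd′ C.c′))
          ≡⟨ cong (λ v → replayLoop n (playAt (suc v) (C.w , C.hw) (state r C.nd′ C.c′)))
                  (parent-child b m) ⟩
        replayLoop n (playAt (suc m) (C.w , C.hw) (state r C.nd′ C.c′))
          ≡⟨ cong (replayLoop n) P.pos≡ ⟩
        replayLoop n (suc m , (P.w , P.hw) , state r P.nd′ P.c′) ∎
        where open ≡-Reasoning

    -- Induction along the path of the old winner `x`. As `x` won every game there, each opponent
    -- stores its LCP with the old head `s`, and the climbing player's entry is relative to `s` as
    -- well. So `s` is the common lower bound that `lcpCompare-outcome` requires.
    climb : ∀ {s r₀ r nd d m x h φ} c → 1 ≤ m → Won (heads r₀) nd d m x φ →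
            heads r₀ x ≡ str s → (∀ k → k ≢ x → heads r k ≡ heads r₀ k) →
            Follows h̄ (str s) h (heads r x) →
            Climbed s r nd c d m (φ + weight (heads r x) h)
                    (suc (K + toℕ x) , (x , h) , state r nd c)
    climb c 1≤m (leaf refl) _ _ follows = record
      { reached = λ n → refl ; won = leaf refl ; follows = follows
      ; frame = λ _ _ → refl ; cost≤ = ≤-refl }
    climb {s} {r₀} {r} {nd} {suc d} {m} {x} {h} c 1≤m
          (game b {y = y} {hy} {φ} {ψ} wx wy at-m x≤y refl) at-x others follows
      with C ← climb {r₀ = r₀} {r} c (1≤child b 1≤m) wx at-x others follows =
      subst (λ sy → Climbed s r nd c (suc d) m ((weight sy hy + (φ + ψ)) + weight (heads r x) h) _)
        y-unchanged
        (climb-step {b = b} 1≤m C (play C.c′ b 1≤m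
          (trans (C.frame m (m⋢child b 1≤m)) at-m)
          C.won
          (Won-cong (λ u u⊑ → C.frame u λ u⊑c → children-disjoint b 1≤m u⊑c u⊑)
                    sibling-unchanged wy)
          C.follows
          (subst₂ (λ sx sy → Follows h̄ sx hy sy) at-x (sym y-unchanged) x≤y)))
      where
      module C = Climbed C

      sibling-unchanged : ∀ k → K + toℕ k ⊑ child (not b) m → heads r k ≡ heads r₀ k
      sibling-unchanged k k⊑ = others k λ { refl → children-disjoint b 1≤m (winner-⊑ wx) k⊑ }

      y-unchanged = sibling-unchanged y (winner-⊑ wy)

    -- Initialization

    data Leaves : ℕ → ℕ → List (Fin K) → Set where
      leaf : ∀ {m k} → K + toℕ k ≡ m → Leaves 0 m (k ∷ [])
      game : ∀ {d m ks ls} → Leaves d (child false m) ks → Leaves d (child true m) ls →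
             Leaves (suc d) m (ks ++ ls)

    insertLoop : ℕ → Position → Position
    insertLoop n = while n (λ (v , _) → isEven v ∧ (2 <ᵇ v)) (λ (v , p , σ) → playAt ⌊ v /2⌋ p σ)

    storeAbove : Position → State
    storeAbove (v , p , σ) = record σ { node = node σ [ ⌈ v /2⌉ ↦ p ] }

    -- The last climb is left suspended at the root of the subtree, because whether it continues
    -- depends on which child that root is. The `suc` in `cost≤` reflects that a subtree of `2 ^ d`
    -- leaves has `2 ^ d - 1` games.
    record Filled (q : Str) (r : Unread) (nd : ℕ → Player) (c d m : ℕ)
                  (σ : State) : Set (a Level.⊔ ℓ) where
      field
        {w}     : Fin K
        {hw}    : ℕ
        {nd′}   : ℕ → Player
        {c′}    : ℕ
        {φ}     : ℕ
        {fuel}  : ℕ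
        reached : σ ≡ storeAbove (insertLoop fuel (suc m , (w , hw) , state r nd′ c′))
        enough  : m < fuel
        won     : Won (heads r) nd′ d m w φ
        follows : Follows h̄ (str q) hw (heads r w)
        frame   : ∀ u → ¬ (u ⊑ m) → nd′ (suc u) ≡ nd (suc u)
        cost≤   : suc c′ ≤ 2 ^ d + (c + φ)

    -- A left child is an odd node: the climb stops and leaves its winner at the parent, for the
    -- climb from the right sibling to meet.
    insertLoop-left : ∀ n m p σ → storeAbove (insertLoop n (suc (child false m) , p , σ))
                                ≡ record σ { node = node σ [ suc m ↦ p ] }
    insertLoop-left n m p σ = trans
      (cong storeAbove (while-stop n (cong (_∧ (2 <ᵇ suc (m + m))) (isEven-1+double m))))
      (cong (λ v → record σ { node = node σ [ suc v ↦ p ] }) (parent-child false m))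

    insertLoop-right : ∀ n {m} p σ → 1 ≤ m → insertLoop (suc n) (suc (child true m) , p , σ)
                                           ≡ insertLoop n (playAt (suc m) p σ)
    insertLoop-right n {m} p σ 1≤m = trans
      (while-step n (cong₂ _∧_ (isEven-double m) (2<1+child true 1≤m)))
      -- Here `v = suc (suc (m + m))`, whose half is `suc ⌊ m + m /2⌋`; hence the fact about the
      -- left child.
      (cong (λ v → insertLoop n (playAt (suc v) p σ)) (parent-child false m))

    fill-cost : ∀ c c₁ c₂ c₃ φ ψ χ N w wx → suc c₁ ≤ N + (c + φ) → suc c₂ ≤ N + (c₁ + ψ) →
                c₃ + ((ψ + φ) + wx) ≤ suc c₂ + (χ + w) → w ≤ wx →
                suc c₃ ≤ (N + (N + 0)) + (c + χ)
    fill-cost c c₁ c₂ c₃ φ ψ χ N w wx left right root w≤ =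
      +-cancelˡ-≤ (c₁ + c₂ + φ + ψ + w + wx + 1) _ _ (begin
        (c₁ + c₂ + φ + ψ + w + wx + 1) + suc c₃
          ≡⟨ solve (c₁ ∷ c₂ ∷ c₃ ∷ φ ∷ ψ ∷ w ∷ wx ∷ []) ⟩
        (suc c₁ + suc c₂) + ((c₃ + ((ψ + φ) + wx)) + w)
          ≤⟨ +-mono-≤ (+-mono-≤ left right) (+-mono-≤ root w≤) ⟩
        ((N + (c + φ)) + (N + (c₁ + ψ))) + ((suc c₂ + (χ + w)) + wx)
          ≡⟨ solve (c ∷ c₁ ∷ c₂ ∷ φ ∷ ψ ∷ χ ∷ N ∷ w ∷ wx ∷ []) ⟩
        (c₁ + c₂ + φ + ψ + w + wx + 1) + ((N + (N + 0)) + (c + χ)) ∎)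
      where open ≤-Reasoning

    fill-step : ∀ {q r nd c d m ks ls} → 1 ≤ m →
      (F : Filled q r nd c d (child false m) (foldl insert (state r nd c) ks)) →
      let module F = Filled F ; nd₁ = F.nd′ [ suc m ↦ (F.w , F.hw) ] in
      (G : Filled q r nd₁ F.c′ d (child true m) (foldl insert (state r nd₁ F.c′) ls)) →
      let module G = Filled G in
      Played q r G.nd′ G.c′ d m (G.φ + F.φ) (weight (heads r G.w) G.hw + weight (heads r F.w) F.hw)
             (playAt (suc m) (G.w , G.hw) (state r G.nd′ G.c′)) →
      Filled q r nd c (suc d) m (foldl insert (state r nd c) (ks ++ ls))
    fill-step {q} {r} {nd} {c} {d} {m} {ks} {ls} 1≤m F G P = record
      { reached = begin
          foldl insert (state r nd c) (ks ++ ls)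
            ≡⟨ foldl-++ insert (state r nd c) ks ls ⟩
          foldl insert (foldl insert (state r nd c) ks) ls
            ≡⟨ cong (λ σ → foldl insert σ ls)
                 (trans F.reached (insertLoop-left F.fuel m (F.w , F.hw) (state r F.nd′ F.c′))) ⟩
          foldl insert (state r nd₁ F.c′) ls
            ≡⟨ G.reached ⟩
          storeAbove (insertLoop G.fuel (suc (child true m) , (G.w , G.hw) , state r G.nd′ G.c′))
            ≡⟨ cong (λ n → storeAbove (insertLoop n (suc (child true m) , (G.w , G.hw) , state r G.nd′ G.c′)))
                 (sym 1+fuel) ⟩
          storeAbove (insertLoop (suc fuel) (suc (child true m) , (G.w , G.hw) , state r G.nd′ G.c′))
            ≡⟨ cong storeAbove (insertLoop-right fuel (G.w , G.hw) (state r G.nd′ G.c′) 1≤m) ⟩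
          storeAbove (insertLoop fuel (playAt (suc m) (G.w , G.hw) (state r G.nd′ G.c′)))
            ≡⟨ cong (λ pos → storeAbove (insertLoop fuel pos)) P.pos≡ ⟩
          storeAbove (insertLoop fuel (suc m , (P.w , P.hw) , state r P.nd′ P.c′)) ∎
      -- The game at `m` used one unit of fuel, and the address fell by at least one.
      ; enough = ≤-trans (m<child true 1≤m) (≤-pred (≤-trans G.enough (≤-reflexive (sym 1+fuel))))
      ; won = P.won
      ; follows = P.follows
      ; frame = λ u u⋢m → trans (P.frame u λ { refl → u⋢m here })
                    (trans (G.frame u λ u⊑c → u⋢m (child-⊑ true u⊑c))
                    (trans (updated-other F.nd′ (suc m) _ λ { refl → u⋢m here })
                           (F.frame u λ u⊑c → u⋢m (child-⊑ false u⊑c))))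
      ; cost≤ = fill-cost c F.c′ G.c′ P.c′ F.φ G.φ P.χ (2 ^ d) _ _ F.cost≤ G.cost≤ P.cost≤ P.winner≤
      }
      where
      open ≡-Reasoning
      module F = Filled F
      module G = Filled G
      module P = Played P
      nd₁ = F.nd′ [ suc m ↦ (F.w , F.hw) ]
      fuel = pred G.fuel
      1+fuel : suc fuel ≡ G.fuel
      1+fuel = suc-pred G.fuel {{>-nonZero (≤-trans (s≤s z≤n) G.enough)}}

    -- No input advances, so all entries stay comparable to one `q`. Leaves are inserted from left
    -- to right: the left subtree is complete, with its winner stored at the parent, before the
    -- right one begins.
    fill : ∀ {q r d m ks} → (∀ k → Follows h̄ (str q) h̄ (heads r k)) → 1 ≤ m →
           Leaves d m ks → ∀ nd c → Filled q r nd c d m (foldl insert (state r nd c) ks)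
    fill {r = r} start 1≤m (leaf {k = k} refl) nd c = record
      { reached = cong (λ v → storeAbove (insertLoop (K + suc (toℕ k)) (v , (k , h̄) , state r nd c)))
                       (+-suc K (toℕ k))
      ; enough = ≤-reflexive (sym (+-suc K (toℕ k)))
      ; won = leaf refl ; follows = start k ; frame = λ _ _ → refl
      ; cost≤ = s≤s (m≤m+n c 0) }
    fill {q} {r} {suc d} {m} start 1≤m (game {ks = ks} {ls} left right) nd c
      with F ← fill {q} {r} start (1≤child false 1≤m) left nd c
      with G ← fill {q} {r} start (1≤child true 1≤m) right
                 (Filled.nd′ F [ suc m ↦ (Filled.w F , Filled.hw F) ]) (Filled.c′ F) =
      -- The right winner is the one that climbs, hence `true`; the left one is the stored opponent.
      fill-step {ks = ks} {ls} 1≤m F G (play G.c′ true 1≤m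
        (trans (G.frame m (m⋢child true 1≤m)) (updated-same F.nd′ (suc m) _))
        G.won
        (Won-cong (λ u u⊑ → G.frame u λ u⊑c → children-disjoint true 1≤m u⊑c u⊑)
                  (λ _ _ → refl) (Won-store 1≤m false F.won))
        G.follows F.follows)
      where
      module F = Filled F
      module G = Filled G

    -- A complete replay

    record Replayed (q : Str) (r : Unread) (c p : ℕ) (weightIn : ℕ) (σ : State) :
                    Set (a Level.⊔ ℓ) where
      field
        {w}     : Fin K
        {hw}    : ℕ
        {nd′}   : ℕ → Player
        {c′}    : ℕ
        {χ}     : ℕ
        σ≡      : σ ≡ state r nd′ c′
        root    : nd′ 1 ≡ (w , hw)
        won     : Won (heads r) nd′ p 1 w χ
        follows : Follows h̄ (str q) hw (heads r w)
        cost≤   : c′ + weightIn ≤ p + c + (χ + weight (heads r w) hw)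

    -- Node 1 has address 0, so it lies outside the subtree of address 1, whose root game is at node
    -- 2.
    store-root : ∀ {cur nd d x φ} p → Won cur nd d 1 x φ → Won cur (nd [ 1 ↦ p ]) d 1 x φ
    store-root {nd = nd} p = Won-cong
      (λ u u⊑1 → updated-other nd 1 p λ { refl → contradiction (⊑⇒≥ u⊑1) λ () })
      (λ _ _ → refl)

    advanced : Fin K → Unread → Unread
    advanced x r = updateAt r x λ (ss , hs) → drop 1 ss , drop 1 hs

    headEntry : List ℕ → ℕ
    headEntry []      = 0
    headEntry (h ∷ _) = h

    nextEntry≡headEntry : ∀ r nd c k → nextEntry (state r nd c) k ≡ headEntry (proj₂ (r k))
    nextEntry≡headEntry r nd c k with proj₂ (r k)
    ... | []    = refl
    ... | _ ∷ _ = refl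

    replay-won : ∀ {s r nd p x φ} c → K ≡ 2 ^ p → Won (heads r) nd p 1 x φ →
                 heads r x ≡ str s →
                 let r′ = advanced x r ; h = headEntry (proj₂ (r x)) in
                 Follows h̄ (str s) h (heads r′ x) →
                 Replayed s r′ c p (φ + weight (heads r′ x) h) (replay x (state r nd c))
    replay-won {s} {r} {nd} {p} {x} {φ} c K≡2^p wx at-x follows = record
      { σ≡ = cong (λ (_ , p , σ) → record σ { node = node σ [ 1 ↦ p ] }) stops
      ; root = updated-same C.nd′ 1 _
      ; won = store-root _ C.won
      ; follows = C.follows
      ; cost≤ = C.cost≤
      }
      where
      r′ = advanced x r
      h  = headEntry (proj₂ (r x))

      module C = Climbed (climb {r₀ = r} {r′} c ≤-refl wx at-x
        (λ k k≢x → cong (λ (ss , _) → head∞ ss) (updateAt-minimal k x r k≢x)) follows)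

      fuel : ℕ
      fuel = K + suc (toℕ x)

      p≤fuel : p ≤ fuel
      p≤fuel = ≤-trans (n≤2^n p) (≤-trans (≤-reflexive (sym K≡2^p)) (m≤m+n K _))

      stops : replayLoop fuel (fuel , (x , nextEntry (state r nd c) x) , state r′ nd c)
            ≡ (2 , (C.w , C.hw) , state r′ C.nd′ C.c′)
      stops = begin
        replayLoop fuel (fuel , (x , nextEntry (state r nd c) x) , state r′ nd c)
          ≡⟨ cong₂ (λ v h → replayLoop fuel (v , (x , h) , state r′ nd c))
               (+-suc K (toℕ x)) (nextEntry≡headEntry r nd c x) ⟩
        replayLoop fuel (suc (K + toℕ x) , (x , h) , state r′ nd c)
          ≡⟨ cong (λ n → replayLoop n (suc (K + toℕ x) , (x , h) , state r′ nd c))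
               (sym (m+[n∸m]≡n p≤fuel)) ⟩
        replayLoop (p + (fuel ∸ p)) (suc (K + toℕ x) , (x , h) , state r′ nd c)
          ≡⟨ C.reached (fuel ∸ p) ⟩
        replayLoop (fuel ∸ p) (2 , (C.w , C.hw) , state r′ C.nd′ C.c′)
          -- The climb of `p` levels ends at node 2, where the loop test fails.
          ≡⟨ while-stop (fuel ∸ p) refl ⟩
        (2 , (C.w , C.hw) , state r′ C.nd′ C.c′) ∎
        where open ≡-Reasoning

    -- Exhausted inputs and the input arrays

    Follows-∞ : ∀ {h sy} → Follows h̄ ∞ h sy → sy ≡ ∞
    Follows-∞ (sentinel _) = refl

    -- Only a sentinel follows a sentinel, so a winning sentinel has beaten sentinels alone, and
    -- these in turn only sentinels.
    sentinel-wins⇒exhausted : ∀ {cur nd d m x φ ks} → Won cur nd d m x φ → Leaves d m ks →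
                              cur x ≡ ∞ → All (λ k → cur k ≡ ∞) ks
    sentinel-wins⇒exhausted {cur} (leaf at-x) (leaf at-k) x∞ =
      trans (cong cur (toℕ-injective (+-cancelˡ-≡ K _ _ (trans at-k (sym at-x))))) x∞ All.∷ All.[]
    sentinel-wins⇒exhausted {cur} (game b {y = y} {h} wx wy _ x≤y _) (game left right) x∞
      with y∞ ← Follows-∞ (subst (λ sx → Follows h̄ sx h (cur y)) x∞ x≤y)
      with b
    ... | false = ++⁺ (sentinel-wins⇒exhausted wx left x∞) (sentinel-wins⇒exhausted wy right y∞)
    ... | true  = ++⁺ (sentinel-wins⇒exhausted wy left y∞) (sentinel-wins⇒exhausted wx right x∞)

    exhausted⇒weightless : ∀ {cur nd d m x φ} → Won cur nd d m x φ →
                           (∀ k → cur k ≡ ∞) → φ ≡ 0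
    exhausted⇒weightless (leaf _) all∞ = refl
    exhausted⇒weightless (game b {y = y} {h} wx wy _ _ refl) all∞
      rewrite all∞ y | exhausted⇒weightless wx all∞ | exhausted⇒weightless wy all∞ = refl

    record ValidInput (ss : List Str) (hs : List ℕ) : Set (a Level.⊔ ℓ) where
      constructor validInput
      field
        entries : hs ≡ lcpArray ss
        sorted  : Sorted ss
        h̄≤      : All (h̄ ≤_) (lcpArray ss)

    ValidInput-drop : ∀ {s ss hs} → ValidInput (s ∷ ss) hs → ValidInput ss (drop 1 hs)
    ValidInput-drop {ss = []}    (validInput refl _        _)       = validInput refl Linked.[] All.[]
    ValidInput-drop {ss = _ ∷ _} (validInput refl (_ Linked.∷ ↗) (_ All.∷ h̄≤)) = validInput refl ↗ h̄≤

    -- Once `s` is written it is the new lower bound, and the input's own LCP entry is already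
    -- relative to it.
    ValidInput-next : ∀ {s ss hs} → ValidInput (s ∷ ss) hs →
                      Follows h̄ (str s) (headEntry hs) (head∞ ss)
    ValidInput-next {ss = []}    (validInput refl _         _)        = sentinel z≤n
    ValidInput-next {ss = _ ∷ _} (validInput refl (s≤t Linked.∷ _) (h̄≤h All.∷ _)) = string s≤t refl h̄≤h

    -- The entry taken from the array is the weight with which the input re-enters the tree; at the
    -- end of the input both are 0.
    ValidInput-L : ∀ {s ss hs} → ValidInput (s ∷ ss) hs →
                   L hs ≡ weight (head∞ ss) (headEntry hs) + L (drop 1 hs)
    ValidInput-L {ss = []}    (validInput refl _ _) = refl
    ValidInput-L {ss = _ ∷ _} (validInput refl _ _) = refl

    -- The main loop

    strings : Unread → List Str
    strings r = concat (tabulate λ k → proj₁ (r k))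

    count : Unread → ℕ
    count r = L (tabulate λ k → length (proj₁ (r k)))

    entrySum : Unread → ℕ
    entrySum r = L (tabulate λ k → L (proj₂ (r k)))

    -- `q` is the string written last, at first the common prefix, and `S₀` is what remains to be
    -- written. The current winner's weight appears on neither side of `cost≤`; `L≡` lets the
    -- preceding step account for it.
    record Merged (q : Str) (r : Unread) (n c p φ : ℕ) (x : Fin K) (h : ℕ)
                  (out : List (Str∞ × ℕ)) (cost : ℕ) : Set (a Level.⊔ ℓ) where
      field
        S₀      : List Str
        sorted  : Sorted (q ∷ S₀)
        perm    : S₀ ↭ strings r
        outputs : map proj₁ out ≡ map str S₀
        entries : map proj₂ out ≡ lcpArray (q ∷ S₀)
        L≡      : L (lcpArray (q ∷ S₀)) ≡ weight (heads r x) h + L (lcpArray S₀)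
        cost≤   : cost + (φ + entrySum r) ≤ c + n * p + L (lcpArray S₀)

    -- `w₀` moves from the arrays into the tree and `w` from the tree to the output; the amount
    -- `c′ + χ` between the replay and the rest of the loop cancels.
    merge-cost : ∀ c c′ cost n p φ χ w₀ w l₀ R′ R → c′ + (φ + w₀) ≤ p + c + (χ + w) →
                 cost + (χ + R′) ≤ c′ + n * p + l₀ → R ≡ w₀ + R′ →
                 cost + (φ + R) ≤ c + (p + n * p) + (w + l₀)
    merge-cost c c′ cost n p φ χ w₀ w l₀ R′ R step rest refl =
      +-cancelˡ-≤ (c′ + χ) _ _ (begin
        (c′ + χ) + (cost + (φ + (w₀ + R′)))
          ≡⟨ solve (c′ ∷ cost ∷ φ ∷ χ ∷ w₀ ∷ R′ ∷ []) ⟩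
        (c′ + (φ + w₀)) + (cost + (χ + R′))
          ≤⟨ +-mono-≤ step rest ⟩
        (p + c + (χ + w)) + (c′ + n * p + l₀)
          ≡⟨ solve (c ∷ c′ ∷ n ∷ p ∷ χ ∷ w ∷ l₀ ∷ []) ⟩
        (c′ + χ) + (c + (p + n * p) + (w + l₀)) ∎)
      where open ≤-Reasoning

    mainLoop-merges : ∀ n {q r nd c p x h φ} → K ≡ 2 ^ p → Leaves p 1 (allFin K) →
      (∀ k → ValidInput (proj₁ (r k)) (proj₂ (r k))) → count r ≡ n →
      nd 1 ≡ (x , h) → Won (heads r) nd p 1 x φ → Follows h̄ (str q) h (heads r x) →
      let (out , σ) = mainLoop n (state r nd c) in Merged q r n c p φ x h out (cost σ)
    mainLoop-merges zero {q} {r} {nd} {c} {p} {x} {h} {φ} K≡2^p leaves valid none root wx follows = record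
      { S₀ = [] ; sorted = Linked.[-] ; perm = ↭-reflexive (sym no-strings)
      ; outputs = refl ; entries = refl
      ; L≡ = cong (λ sx → weight sx h + 0) (sym (all∞ x))
      ; cost≤ = ≤-reflexive (begin
          c + (φ + entrySum r) ≡⟨ cong₂ (λ φ R → c + (φ + R)) (exhausted⇒weightless wx all∞) no-entries ⟩
          c + 0                ≡⟨ sym (+-identityʳ (c + 0)) ⟩
          c + 0 + 0            ∎)
      }
      where
      open ≡-Reasoning
      empty : ∀ k → proj₁ (r k) ≡ []
      empty k = length≡0⇒[] (sum-tabulate≡0 _ none k)
        where
        length≡0⇒[] : ∀ {ss : List Str} → length ss ≡ 0 → ss ≡ []
        length≡0⇒[] {[]} _ = refl
      all∞ : ∀ k → heads r k ≡ ∞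
      all∞ k = cong head∞ (empty k)
      no-strings : strings r ≡ []
      no-strings = concat-tabulate-[] _ empty
      no-entries : entrySum r ≡ 0
      no-entries = sum-tabulate-0 _ λ k →
        cong L (trans (ValidInput.entries (valid k)) (cong lcpArray (empty k)))
    mainLoop-merges (suc n) {q} {r} {nd} {c} {p} {x} {h} {φ} K≡2^p leaves valid some root wx follows
      with proj₁ (r x) in read-x
    -- A winner without unread strings is a sentinel, so every input is exhausted, against
    -- `count r ≡ suc n`.
    ... | [] = contradiction (trans (sym some) (sum-tabulate-0 _ λ k →
                 cong length (head∞-∞ (All.lookup exhausted (∈-allFin k))))) λ ()
      where
      exhausted = sentinel-wins⇒exhausted wx leaves (cong head∞ read-x)
      head∞-∞ : ∀ {ss} → head∞ ss ≡ ∞ → ss ≡ []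
      head∞-∞ {[]} _ = refl
    mainLoop-merges (suc n) {q} {r} {nd} {c} {p} {x} {h} {φ} K≡2^p leaves valid some root wx (string q≤s q-s h̄≤h)
      | s ∷ ss = record
      { S₀ = s ∷ M.S₀
      ; sorted = q≤s Linked.∷ M.sorted
      ; perm = ↭-trans (prep s M.perm) (↭-sym (concat-tabulate-uncons _ _ x
          (trans read-x (cong (s ∷_) (sym read-x′))) λ k k≢x → cong proj₁ (sym (others k k≢x))))
      ; outputs = cong₂ _∷_ out-string (trans (cong (λ σ → map proj₁ (proj₁ (mainLoop n σ))) replayed≡) M.outputs)
      -- The entry written is `h`, which `q-s` identifies as the LCP with the preceding string.
      ; entries = cong₂ _∷_ (trans (cong proj₂ root) (sym q-s))
                    (trans (cong (λ σ → map proj₂ (proj₁ (mainLoop n σ))) replayed≡) M.entries)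
      ; L≡ = cong (_+ L (lcpArray (s ∷ M.S₀)))
             (trans q-s (cong (λ ss → weight (head∞ ss) h) (sym read-x)))
      ; cost≤ = subst₂ (λ C l → C + (φ + entrySum r) ≤ c + (p + n * p) + l)
          (cong (λ σ → cost (proj₂ (mainLoop n σ))) (sym replayed≡)) (sym M.L≡)
          (merge-cost c P.c′ (cost (proj₂ (mainLoop n (state r′ P.nd′ P.c′)))) n p φ P.χ _ _ _ (entrySum r′) _ P.cost≤ M.cost≤ entries-x)
      }
      where
      r′ = advanced x r

      valid-x : ValidInput (s ∷ ss) (proj₂ (r x))
      valid-x = subst (λ ss → ValidInput ss (proj₂ (r x))) read-x (valid x)

      r′-x : r′ x ≡ (drop 1 (proj₁ (r x)) , drop 1 (proj₂ (r x)))
      r′-x = updateAt-updates x r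

      others : ∀ k → k ≢ x → r′ k ≡ r k
      others k k≢x = updateAt-minimal k x r k≢x

      read-x′ : proj₁ (r′ x) ≡ ss
      read-x′ = trans (cong proj₁ r′-x) (cong (drop 1) read-x)

      valid′ : ∀ k → ValidInput (proj₁ (r′ k)) (proj₂ (r′ k))
      valid′ k with k ≟ᶠ x
      ... | yes refl = subst₂ ValidInput (sym read-x′) (sym (cong proj₂ r′-x)) (ValidInput-drop valid-x)
      ... | no  k≢x  = subst (λ (ss , hs) → ValidInput ss hs) (sym (others k k≢x)) (valid k)

      module P = Replayed (replay-won {r = r} c K≡2^p wx (cong head∞ read-x)
        (subst (λ ss → Follows h̄ (str s) (headEntry (proj₂ (r x))) (head∞ ss)) (sym read-x′)
          (ValidInput-next valid-x)))

      replayed≡ : replay (proj₁ (nd 1)) (state r nd c) ≡ state r′ P.nd′ P.c′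
      replayed≡ = trans (cong (λ y → replay (proj₁ y) (state r nd c)) root) P.σ≡

      out-string : current (state r nd c) (proj₁ (nd 1)) ≡ str s
      out-string = trans (cong (λ y → current (state r nd c) (proj₁ y)) root)
                         (trans (current≡heads r nd c x) (cong head∞ read-x))

      one-less : count r′ ≡ n
      one-less = suc-injective (trans (sym (sum-tabulate-change _ _ x
        (trans (cong length read-x) (cong (λ ss → suc (length ss)) (sym read-x′)))
        λ k k≢x → cong (λ i → length (proj₁ i)) (sym (others k k≢x)))) some)

      entries-x : entrySum r ≡ weight (heads r′ x) (headEntry (proj₂ (r x))) + entrySum r′
      entries-x = sum-tabulate-change _ _ x
        (trans (ValidInput-L valid-x)
          (cong₂ (λ ss hs → weight (head∞ ss) (headEntry (proj₂ (r x))) + L hs)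
            (sym read-x′) (sym (cong proj₂ r′-x))))
        λ k k≢x → cong (λ i → L (proj₂ i)) (sym (others k k≢x))

      module M = Merged (mainLoop-merges n {r = r′} {c = P.c′} K≡2^p leaves valid′ one-less P.root P.won P.follows)

    -- Initial conditions and assembly

    tabulate-leaves : ∀ d m (f : Fin (2 ^ d) → Fin K) →
                      (∀ j → K + toℕ (f j) ≡ 2 ^ d * m + toℕ j) → Leaves d m (tabulate f)
    tabulate-leaves zero    m f at =
      leaf (trans (at fzero) (trans (+-identityʳ _) (+-identityʳ m)))
    -- The leaves `d` levels below `m` fill a block of addresses starting at `2 ^ d * m`, which is
    -- `K` for the root; each half of a block belongs to one child.
    tabulate-leaves (suc d) m f at = subst (Leaves (suc d) m) (sym split) (game
      (tabulate-leaves d (m + m) (λ j → f (j ↑ˡ (N + 0))) λ j → begin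
        K + toℕ (f (j ↑ˡ (N + 0)))  ≡⟨ at (j ↑ˡ (N + 0)) ⟩
        2N * m + toℕ (j ↑ˡ (N + 0)) ≡⟨ cong (2N * m +_) (toℕ-↑ˡ j (N + 0)) ⟩
        2N * m + toℕ j              ≡⟨ cong (_+ toℕ j) (double N m) ⟩
        N * (m + m) + toℕ j         ∎)
      (tabulate-leaves d (suc (m + m)) (λ j → f (N ↑ʳ (j ↑ˡ 0))) λ j → begin
        K + toℕ (f (N ↑ʳ (j ↑ˡ 0)))  ≡⟨ at (N ↑ʳ (j ↑ˡ 0)) ⟩
        2N * m + toℕ (N ↑ʳ (j ↑ˡ 0)) ≡⟨ cong (2N * m +_) (toℕ-↑ʳ N (j ↑ˡ 0)) ⟩
        2N * m + (N + toℕ (j ↑ˡ 0))  ≡⟨ cong (λ i → 2N * m + (N + i)) (toℕ-↑ˡ j 0) ⟩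
        2N * m + (N + toℕ j)         ≡⟨ double+1 N m (toℕ j) ⟩
        N * suc (m + m) + toℕ j      ∎))
      where
      open ≡-Reasoning
      N  = 2 ^ d
      2N = N + (N + 0)
      double : ∀ N m → (N + (N + 0)) * m ≡ N * (m + m)
      double = solve-∀
      double+1 : ∀ N m j → (N + (N + 0)) * m + (N + j) ≡ N * suc (m + m) + j
      double+1 = solve-∀
      -- `2 * N` unfolds to `N + (N + 0)`, which leaves an empty third block to remove.
      split : tabulate f ≡ tabulate (λ j → f (j ↑ˡ (N + 0))) ++ tabulate (λ j → f (N ↑ʳ (j ↑ˡ 0)))
      split = trans (tabulate-+ N f) (cong (tabulate (λ j → f (j ↑ˡ (N + 0))) ++_)
        (trans (tabulate-+ N (λ j → f (N ↑ʳ j))) (++-identityʳ _)))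

    prefixes-lcpArray : ∀ {c} ss → length c ≡ h̄ → All (Prefix _≡_ c) ss →
                        All (h̄ ≤_) (lcpArray ss)
    prefixes-lcpArray []           refl _   = All.[]
    prefixes-lcpArray (_ ∷ [])     refl _   = All.[]
    prefixes-lcpArray (_ ∷ t ∷ ss) refl (c⊑s All.∷ c⊑t All.∷ c⊑ss) =
      prefix-lcp c⊑s c⊑t All.∷ prefixes-lcpArray (t ∷ ss) refl (c⊑t All.∷ c⊑ss)

    prefix-head : ∀ {c} ss → length c ≡ h̄ → All (Prefix _≡_ c) ss →
                  Follows h̄ (str c) h̄ (head∞ ss)
    prefix-head []      refl _ = sentinel ≤-refl
    prefix-head (_ ∷ _) refl (c⊑s All.∷ _) =
      let (c≤s , eq) = prefix-below c⊑s in string c≤s eq ≤-refl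

    total-cost : ∀ p c cost φ R l → suc c ≤ 2 ^ p + (0 + φ) →
                 cost + (φ + R) ≤ c + numStrings * p + l →
                 cost + R ≤ l + (numStrings * p + 2 ^ p)
    total-cost p c cost φ R l initial loop =
      +-cancelˡ-≤ (c + φ) _ _ (begin
        (c + φ) + (cost + R)                         ≡⟨ rearrange c φ cost R ⟩
        -- One comparison is given away: initialization needs only `2 ^ p - 1` last tests.
        c + (cost + (φ + R))                         ≤⟨ +-mono-≤ (<⇒≤ initial) loop ⟩
        (2 ^ p + (0 + φ)) + (c + numStrings * p + l) ≡⟨ rearrange′ (2 ^ p) φ c (numStrings * p) l ⟩
        (c + φ) + (l + (numStrings * p + 2 ^ p))     ∎)
      where
      open ≤-Reasoning
      rearrange : ∀ c φ cost R → (c + φ) + (cost + R) ≡ c + (cost + (φ + R))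
      rearrange = solve-∀
      rearrange′ : ∀ N φ c np l → (N + (0 + φ)) + (c + np + l) ≡ (c + φ) + (l + (np + N))
      rearrange′ = solve-∀

  -- The sum that `ΔL` subtracts stands on the left, which keeps the count in ℕ.
  merge-correct : ∀ {K p} → K ≡ 2 ^ p → (S : Fin K → List Str) (H : Fin K → List ℕ) (h̄ : ℕ) →
    (∀ k → Sorted (S k)) → (∀ k → H k ≡ lcpArray (S k)) → HaveCommonPrefix h̄ (allStrings S) →
    let open Merge S H h̄ in ∀ memory →
    ∃[ S₀ ] Sorted S₀ × S₀ ↭ allStrings S
          × map proj₁ (output memory) ≡ map str S₀
          × drop 1 (map proj₂ (output memory)) ≡ lcpArray S₀
          × comparisons memory + sum (tabulate λ k → L (H k))
              ≤ L (lcpArray S₀) + (numStrings * p + K)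
  merge-correct {p = p} refl S H h̄ sorted lcps (c , length-c , common) memory =
    M.S₀ , Linked.tail M.sorted , M.perm ,
    trans (cong (λ σ → map proj₁ (proj₁ (mainLoop numStrings σ))) initialized) M.outputs ,
    -- The first entry written is relative to `c` and stands where the LCP array has ⊥.
    trans (cong (λ σ → drop 1 (map proj₂ (proj₁ (mainLoop numStrings σ)))) initialized)
          (trans (cong (drop 1) M.entries) (drop-lcpArray M.S₀)) ,
    subst (λ σ → cost (proj₂ (mainLoop numStrings σ)) + entrySum S H h̄ r
                 ≤ L (lcpArray M.S₀) + (numStrings * p + 2 ^ p))
      (sym initialized)
      (total-cost S H h̄ p F.c′ (cost (proj₂ (mainLoop numStrings (state r nd F.c′)))) F.φ _ _ F.cost≤ M.cost≤)
    where
    open Merge S H h̄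

    r : Unread S H h̄
    r k = S k , H k

    prefixes : ∀ k → All (Prefix _≡_ c) (S k)
    prefixes k = All.tabulate λ s∈ → common (∈-concat⁺′ s∈ (∈-tabulate⁺ k))

    leaves : Leaves S H h̄ p 1 (allFin (2 ^ p))
    leaves = tabulate-leaves S H h̄ p 1 (λ k → k) λ j → cong (_+ toℕ j) (sym (*-identityʳ (2 ^ p)))

    module F = Filled (fill S H h̄ {c} {r} (λ k → prefix-head S H h̄ (S k) length-c (prefixes k))
                        ≤-refl leaves memory 0)

    nd : ℕ → Player
    nd = F.nd′ [ 1 ↦ (F.w , F.hw) ]

    initialized : initialize memory ≡ state r nd F.c′
    -- The last climb is suspended at node 2; the loop test fails there and the winner is stored at
    -- node 1.
    initialized = trans F.reached (cong (storeAbove S H h̄) (while-stop F.fuel refl))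

    module M = Merged (mainLoop-merges S H h̄ numStrings {r = r} {nd} {F.c′} refl leaves
      (λ k → validInput (lcps k) (sorted k) (prefixes-lcpArray S H h̄ (S k) length-c (prefixes k)))
      refl (updated-same F.nd′ 1 _) (store-root S H h̄ _ F.won) F.follows)

    drop-lcpArray : ∀ ss → drop 1 (lcpArray (c ∷ ss)) ≡ lcpArray ss
    drop-lcpArray []      = refl
    drop-lcpArray (_ ∷ _) = refl

-- The bound over the integers

-- Opened only here because +_ would make sections like (m +_) on ℕ ambiguous.
open import Data.Integer.Base as ℤ using (+_)

≤⇒ℤ≤ : ∀ {c R l b} → c + R ≤ l + b → + c ℤ.≤ + l ℤ.- + R ℤ.+ + b
≤⇒ℤ≤ {c} {R} {l} {b} c+R≤l+b = begin
  + c                             ≡⟨ rearrange (+ c) (+ R) ⟩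
  + c ℤ.+ + R ℤ.- + R             ≤⟨ ℤₚ.+-monoˡ-≤ (ℤ.- + R) (ℤ.+≤+ c+R≤l+b) ⟩
  + l ℤ.+ + b ℤ.- + R             ≡⟨ rearrange′ (+ l) (+ b) (+ R) ⟩
  + l ℤ.- + R ℤ.+ + b             ∎
  where
  open ℤₚ.≤-Reasoning
  rearrange : ∀ c R → c ≡ c ℤ.+ R ℤ.- R
  rearrange = ℤSolver.solve-∀
  rearrange′ : ∀ l b R → l ℤ.+ b ℤ.- R ≡ l ℤ.- R ℤ.+ b
  rearrange′ = ℤSolver.solve-∀

mainTheorem4 : ∀ {a ℓ} {A : Set a} {_≼_ : Rel A ℓ} (isOrder : IsDecTotalOrder _≡_ _≼_) →
    let open LCPMerge isOrder in
    ∀ (K : ℕ) → PowerOfTwo K →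
    (S : Fin K → List Str) (H : Fin K → List ℕ) (h̄ : ℕ) →
    (∀ k → Sorted (S k)) →
    (∀ k → H k ≡ lcpArray (S k)) →
    HaveCommonPrefix h̄ (allStrings S) →
    let open Merge S H h̄ in
    ∀ (memory : ℕ → Player) →
    ∃[ S₀ ] Sorted S₀
    × S₀ ↭ allStrings S
    × map proj₁ (output memory) ≡ map str S₀
    × drop 1 (map proj₂ (output memory)) ≡ lcpArray S₀
    × (+ comparisons memory) ℤ.≤
    ΔL (lcpArray S₀) H ℤ.+ (+ (numStrings * ⌊log₂ K ⌋ + K))
mainTheorem4 isOrder K (p , refl) S H h̄ sorted lcps common memory
  with S₀ , ↗ , perm , outputs , entries , cost≤ ←
       merge-correct isOrder {p = p} refl S H h̄ sorted lcps common memory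
  rewrite ⌊log₂[2^n]⌋≡n p = S₀ , ↗ , perm , outputs , entries , ≤⇒ℤ≤ cost≤
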